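{- Let $t,\ell,m$ be integers with $1 \le t \le \ell \le m$, and let $s$ be an integer with $(\ell-t)m \le s \le \ell m$ and $s\ge 1$. Then the $s$-th generalized Hamming weight of $\widehat{C}_{\det}(t;\ell,m)$ is $$\hat{d}_s=\hat{n}-\sum_{i=0}^{\ell m-s-1}q^i,$$ where $\hat n=|\widehat{\mathcal D}_t(\ell,m)|$ is the length of the code (the sum is empty, i.e. $0$, when $s=\ell m$).
   Context: $q$ is a prime power. Let $\widehat{\mathcal D}_t(\ell,m)\subset\mathbb{P}^{\ell m-1}(\mathbb{F}_q)=\mathbb{P}(\mathrm{Mat}_{\ell\times m}(\mathbb{F}_q))$ be the set of points $[M]$ with $M\ne 0$ and $\mathrm{rk}(M)\le t$; let $\hat n=|\widehat{\mathcal D}_t(\ell,m)|$, enumerate its points and choose representatives $M_1,\dots,M_{\hat n}$. The determinantal code $\widehat{C}_{\det}(t;\ell,m)\subseteq\mathbb{F}_q^{\hat n}$ is the set of vectors $(f(M_1),\dots,f(M_{\hat n}))$ for $f$ ranging over linear forms in the entries of an $\ell\times m$ matrix of indeterminates; it has dimension $\ell m$. For a linear code $C\subseteq\mathbb{F}_q^n$ and a subspace $D\subseteq C$, the support weight $\|D\|$ is the number of coordinates $i$ such that some $c\in D$ has $c_i\ne0$; the $s$-th generalized Hamming weight is $d_s(C)=\min\{\|D\|: D\subseteq C \text{ a subspace}, \dim D=s\}$. -}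

module Defs where

open import Level using (_⊔_; suc)
open import Algebra.Apartness.Bundles using (HeytingCommutativeRing; HeytingField)
import Algebra.Apartness.Properties.HeytingCommutativeRing as HeytingProperties
import Algebra.Properties.Semiring.Sum as SemiringSum
open import Algebra.Bundles using (CommutativeRing)
open import Data.Fin.Base using (Fin)
open import Data.Fin.Subset using (Subset; ∣_∣) renaming (_∈_ to _∈ₛ_)
open import Data.List.Base using (map; upTo) renaming (sum to sumᴸ)
open import Data.Nat.Base as ℕ using (ℕ)
open import Data.Nat.Primality using (Prime)
open import Data.Product.Base using (Σ-syntax; ∃-syntax; ∃₂; _×_; _,_; proj₁; proj₂)
open import Data.Vec.Functional using (Vector)
import Data.Vec.Functional.Relation.Binary.Equality.Setoid as VectorEquality
open import Function.Base using (_on_)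
open import Function.Bundles using (Inverse; _⇔_)
open import Relation.Binary.Bundles using (Setoid)
open import Relation.Binary.PropositionalEquality using (_≡_)
import Relation.Binary.PropositionalEquality as ≡
open import Relation.Unary using (Pred; _∈_; _⊆_; _≐_)

IsPrimePower : ℕ → Set
IsPrimePower q = ∃[ p ] ∃[ k ] Prime p × 1 ℕ.≤ k × q ≡ p ℕ.^ k

-- 1 + q + ⋯ + q^(k-1), which is 0 when k = 0
geometricSum : ℕ → ℕ → ℕ
geometricSum q k = sumᴸ (map (q ℕ.^_) (upTo k))

-- A finite field is a Heyting field whose carrier setoid is in bijection
-- with Fin q.  Finiteness makes ≈ and # decidable, so x # y is then the
-- same as ¬ (x ≈ y); "nonzero" is always rendered as # 0#.
HasOrder : ∀ {c ℓ₁ ℓ₂} → HeytingField c ℓ₁ ℓ₂ → ℕ → Set (c ⊔ ℓ₁)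
HasOrder F q = Inverse (≡.setoid (Fin q)) (HeytingField.setoid F)

module OverField {c ℓ₁ ℓ₂} (F : HeytingField c ℓ₁ ℓ₂) where

  open HeytingField F
  open HeytingCommutativeRing heytingCommutativeRing using (commutativeRing)
  open CommutativeRing commutativeRing using (semiring)
  open SemiringSum semiring using (sum-syntax; sum-cong-≋; ∑-distrib-+; *-distribˡ-sum; sum-replicate-zero)
  open HeytingProperties heytingCommutativeRing
    using (x-0≈x; 1#0; x#0y#0→xy#0; invertibleˡ⇒#)
  open VectorEquality setoid using (_≋_)
  import Relation.Binary.Reasoning.Setoid setoid as ≈-Reasoning

  _+ᵛ_ : ∀ {n} → Vector Carrier n → Vector Carrier n → Vector Carrier n
  (x +ᵛ y) i = x i + y i

  _*ᵛ_ : ∀ {n} → Carrier → Vector Carrier n → Vector Carrier n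
  (a *ᵛ x) i = a * x i

  0ᵛ : ∀ {n} → Vector Carrier n
  0ᵛ _ = 0#

  record Subspace (n : ℕ) : Set (suc (c ⊔ ℓ₁)) where
    field
      member   : Pred (Vector Carrier n) (c ⊔ ℓ₁)
      resp     : ∀ {x y} → x ≋ y → x ∈ member → y ∈ member
      0-closed : 0ᵛ ∈ member
      +-closed : ∀ {x y} → x ∈ member → y ∈ member → (x +ᵛ y) ∈ member
      *-closed : ∀ a {x} → x ∈ member → (a *ᵛ x) ∈ member

  open Subspace public using (member)

  combination : ∀ {n k} → Vector Carrier k → Vector (Vector Carrier n) k → Vector Carrier n
  combination {k = k} a v i = ∑[ j < k ] (a j * v j i)

  Span : ∀ {n k} → Vector (Vector Carrier n) k → Pred (Vector Carrier n) (c ⊔ ℓ₁)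
  Span v x = ∃[ a ] x ≋ combination a v

  LinearlyIndependent : ∀ {n k} → Vector (Vector Carrier n) k → Set (c ⊔ ℓ₁)
  LinearlyIndependent v = ∀ a → combination a v ≋ 0ᵛ → a ≋ 0ᵛ

  HasDimension : ∀ {n} → Pred (Vector Carrier n) (c ⊔ ℓ₁) → ℕ → Set (c ⊔ ℓ₁)
  HasDimension {n} V s =
    Σ[ v ∈ Vector (Vector Carrier n) s ] LinearlyIndependent v × V ≐ Span v

  HasSupportWeight : ∀ {n} → Subspace n → ℕ → Set (c ⊔ ℓ₁ ⊔ ℓ₂)
  HasSupportWeight {n} D w =
    Σ[ S ∈ Subset n ]
      (∀ i → i ∈ₛ S ⇔ (∃[ x ] x ∈ member D × x i # 0#)) × ∣ S ∣ ≡ w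

  IsGeneralizedHammingWeight : ∀ {n} → Subspace n → ℕ → ℕ → Set (suc (c ⊔ ℓ₁) ⊔ ℓ₂)
  IsGeneralizedHammingWeight {n} C s d =
    (Σ[ D ∈ Subspace n ]
       member D ⊆ member C × HasDimension (member D) s × HasSupportWeight D d)
    × (∀ (D : Subspace n) w →
         member D ⊆ member C → HasDimension (member D) s → HasSupportWeight D w → d ℕ.≤ w)

  Matrix : ℕ → ℕ → Set c
  Matrix ℓ m = Vector (Vector Carrier m) ℓ

  -- The rank is the dimension of the row space; a matrix is the vector of its rows.
  HasRank : ∀ {ℓ m} → Matrix ℓ m → ℕ → Set (c ⊔ ℓ₁)
  HasRank M r = HasDimension (Span M) r

  Rank≤ : ∀ {ℓ m} → ℕ → Matrix ℓ m → Set (c ⊔ ℓ₁)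
  Rank≤ t M = ∃[ r ] HasRank M r × r ℕ.≤ t

  NonZeroMatrix : ∀ {ℓ m} → Matrix ℓ m → Set ℓ₂
  NonZeroMatrix M = ∃₂ λ i j → M i j # 0#

  Proportional : ∀ {ℓ m} → Matrix ℓ m → Matrix ℓ m → Set (c ⊔ ℓ₁ ⊔ ℓ₂)
  Proportional M N = ∃[ a ] a # 0# × (∀ i → M i ≋ (a *ᵛ N i))

  private
    inverse : ∀ {a} → a # 0# → ∃[ b ] b # 0# × b * a ≈ 1#
    inverse {a} a#0 with #⇒invertible a#0
    ... | b , ba≈1 , ab≈1 =
      b
      , invertibleˡ⇒# (a - 0# , trans (*-congˡ (x-0≈x b)) ab≈1)
      , trans (*-congˡ (sym (x-0≈x a))) ba≈1

  proportional-refl : ∀ {ℓ m} {M : Matrix ℓ m} → Proportional M M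
  proportional-refl = 1# , 1#0 , λ i j → sym (*-identityˡ _)

  proportional-sym : ∀ {ℓ m} {M N : Matrix ℓ m} → Proportional M N → Proportional N M
  proportional-sym {M = M} {N} (a , a#0 , M≈aN) with inverse a#0
  ... | b , b#0 , ba≈1 = b , b#0 , λ i j → begin
    N i j            ≈⟨ *-identityˡ _ ⟨
    1# * N i j       ≈⟨ *-congʳ ba≈1 ⟨
    (b * a) * N i j  ≈⟨ *-assoc _ _ _ ⟩
    b * (a * N i j)  ≈⟨ *-congˡ (M≈aN i j) ⟨
    b * M i j        ∎
    where open ≈-Reasoning

  proportional-trans : ∀ {ℓ m} {L M N : Matrix ℓ m} →
                       Proportional L M → Proportional M N → Proportional L N
  proportional-trans (a , a#0 , L≈aM) (b , b#0 , M≈bN) =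
    a * b , x#0y#0→xy#0 a#0 b#0 ,
    λ i j → trans (L≈aM i j) (trans (*-congˡ (M≈bN i j)) (sym (*-assoc _ _ _)))

  -- Points of ℙ(Mat ℓ×m) are given by nonzero representatives, and two of them
  -- are equal when they are proportional.
  DeterminantalVariety : ℕ → ℕ → ℕ → Setoid (c ⊔ ℓ₁ ⊔ ℓ₂) (c ⊔ ℓ₁ ⊔ ℓ₂)
  DeterminantalVariety t ℓ m = record
    { Carrier = Σ[ M ∈ Matrix ℓ m ] NonZeroMatrix M × Rank≤ t M
    ; _≈_     = Proportional on proj₁
    ; isEquivalence = record
      { refl  = proportional-refl
      ; sym   = proportional-sym
      ; trans = proportional-trans
      }
    }

  -- An enumeration M₁, …, M_n̂ of the points with chosen representatives;
  -- its existence says that the variety has exactly n̂ points.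
  Enumeration : ℕ → ℕ → ℕ → ℕ → Set (c ⊔ ℓ₁ ⊔ ℓ₂)
  Enumeration t ℓ m n̂ = Inverse (≡.setoid (Fin n̂)) (DeterminantalVariety t ℓ m)

  representative : ∀ {t ℓ m n̂} → Enumeration t ℓ m n̂ → Fin n̂ → Matrix ℓ m
  representative e k = proj₁ (Inverse.to e k)

  -- The value at M of the linear form ∑ A i j · X i j.
  linearForm : ∀ {ℓ m} → Matrix ℓ m → Matrix ℓ m → Carrier
  linearForm {ℓ} {m} A M = ∑[ i < ℓ ] ∑[ j < m ] (A i j * M i j)

  private
    linearForm-0 : ∀ {ℓ m} (M : Matrix ℓ m) → linearForm (λ _ → 0ᵛ) M ≈ 0#
    linearForm-0 {ℓ} {m} M = trans
      (sum-cong-≋ λ i → trans (sum-cong-≋ λ j → zeroˡ (M i j)) (sum-replicate-zero m))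
      (sum-replicate-zero ℓ)

    linearForm-+ : ∀ {ℓ m} (A B M : Matrix ℓ m) →
                   linearForm (λ i → A i +ᵛ B i) M ≈ linearForm A M + linearForm B M
    linearForm-+ {ℓ} {m} A B M = trans
      (sum-cong-≋ λ i → trans
        (sum-cong-≋ λ j → distribʳ (M i j) (A i j) (B i j))
        (∑-distrib-+ (λ j → A i j * M i j) (λ j → B i j * M i j)))
      (∑-distrib-+ (λ i → ∑[ j < m ] (A i j * M i j)) (λ i → ∑[ j < m ] (B i j * M i j)))

    linearForm-* : ∀ {ℓ m} a (A M : Matrix ℓ m) →
                   linearForm (λ i → a *ᵛ A i) M ≈ a * linearForm A M
    linearForm-* {ℓ} {m} a A M = sym (trans
      (*-distribˡ-sum a (λ i → ∑[ j < m ] (A i j * M i j)))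
      (sum-cong-≋ λ i → trans
        (*-distribˡ-sum a (λ j → A i j * M i j))
        (sum-cong-≋ λ j → sym (*-assoc a (A i j) (M i j)))))

  determinantalCode : ∀ {t ℓ m n̂} → Enumeration t ℓ m n̂ → Subspace n̂
  determinantalCode {ℓ = ℓ} {m} e = record
    { member   = λ x → Σ[ A ∈ Matrix ℓ m ] (∀ k → x k ≈ linearForm A (representative e k))
    ; resp     = λ x≋y (A , x≈A) → A , λ k → trans (sym (x≋y k)) (x≈A k)
    ; 0-closed = (λ _ → 0ᵛ) , λ k → sym (linearForm-0 (representative e k))
    ; +-closed = λ (A , x≈A) (B , y≈B) → (λ i → A i +ᵛ B i) , λ k →
        trans (+-cong (x≈A k) (y≈B k)) (sym (linearForm-+ A B (representative e k)))
    ; *-closed = λ a (A , x≈A) → (λ i → a *ᵛ A i) , λ k →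
        trans (*-congˡ (x≈A k)) (sym (linearForm-* a A (representative e k)))
    }

{-# OPTIONS --safe #-}
module Submission where

-- An s-dimensional subcode D is evaluation on an s-dimensional space 𝒜 of
-- matrices, and D vanishes at the coordinate M exactly when M lies in the
-- annihilator of 𝒜, which has dimension r = ℓm − s.  At most 1 + q + ⋯ + q^(r-1)
-- points lie in that annihilator.  Equality holds when it consists of matrices
-- of rank ≤ t only; since r ≤ tm it can be taken to be all matrices supported in
-- the first r entries in row-major order, which vanish outside the first t rows.

open import Defs
open import Algebra.Apartness.Bundles using (HeytingField; HeytingCommutativeRing)
import Algebra.Apartness.Properties.HeytingCommutativeRing as HeytingProperties
open import Algebra.Bundles using (CommutativeRing)
import Algebra.Properties.CommutativeSemigroup as CommutativeSemigroupProperties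
import Algebra.Properties.Ring as RingProperties
import Algebra.Properties.Semiring.Sum as SemiringSum
open import Data.Fin.Base
  using (Fin; zero; suc; toℕ; cast; combine; remQuot; finToFun; funToFin; inject≤; fromℕ<;
    punchIn; punchOut; _↑ˡ_; _↑ʳ_)
open import Data.Fin.Properties
  using (any?; all?; ¬∀⟶∃¬; injective⇒≤; combine-remQuot; remQuot-combine; finToFun-funToFin;
    funToFin-finToFin; punchInᵢ≢i; punchIn-injective; punchIn-punchOut; suc-injective;
    toℕ-injective; toℕ-inject≤; toℕ-cast; toℕ-↑ˡ; toℕ-↑ʳ; toℕ-combine; toℕ<n; toℕ-fromℕ<)
import Data.Fin.Properties as Fin
open import Data.Fin.Subset using (Subset; ∣_∣; ∁; inside; outside) renaming (_∈_ to _∈ₛ_)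
open import Data.Fin.Subset.Properties using (∣∁p∣≡n∸∣p∣; ∣p∣≤n; x∈∁p⇒x∉p; x∉p⇒x∈∁p)
open import Data.Integer.Base using (+_; _-_; _⊖_)
open import Data.Integer.Properties using (m-n≡m⊖n; ⊖-≥)
open import Data.List.Base using (map; upTo; _∷ʳ_; [_])
open import Data.List.Properties using (applyUpTo-∷ʳ; map-++)
open import Data.Nat.Base using (ℕ; _≤_; _*_; _∸_)
import Data.Nat.Base as ℕ
open import Data.Nat.ListAction using (sum)
open import Data.Nat.ListAction.Properties using (sum-++)
import Data.Nat.Properties as ℕₚ
open import Data.Product.Base using (Σ-syntax; ∃-syntax; ∃₂; _×_; _,_; proj₁; proj₂; uncurry; map₂)
open import Data.Sum.Base using (_⊎_; inj₁; inj₂)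
open import Data.Vec.Base using (_∷_; tabulate; here; there)
open import Data.Vec.Properties using (lookup∘tabulate; []=⇒lookup; lookup⇒[]=)
open import Data.Vec.Functional using (Vector; tail) renaming (_∷_ to _∷ᵛ_)
import Data.Vec.Functional.Relation.Binary.Equality.Setoid as VectorEquality
open import Function.Base using (_∘_; id)
open import Function.Bundles using (Inverse; _⇔_; mk⇔; Equivalence)
open import Function.Definitions using (Injective)
open import Relation.Binary.Bundles using (Setoid)
open import Relation.Binary.PropositionalEquality using (_≡_; _≢_; _≗_)
import Relation.Binary.PropositionalEquality as ≡
open import Relation.Nullary using (¬_; Dec; yes; no; contradiction; does; decidable-stable)
import Relation.Nullary.Decidable as Dec
open import Relation.Unary using (_∈_; _⊆_; Decidable)

-- Both bounds come from injections between finite sets. A set `S` of points has an affine cone of 1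
-- + ∣S∣ (q - 1) vectors, and q^r = 1 + (q - 1)(1 + q + ⋯ + q^(r-1)), so comparing the cone with F^r
-- compares ∣S∣ with the geometric sum. The dimension of the annihilator is never computed: from
-- above, r further functionals separate its vectors; from below, r independent vectors in it are
-- exhibited. That the extremal subcode really has dimension s rests on the matrix units: their rank
-- is at most 1 ≤ t, so up to scalars they are evaluation points, and distinct entries give
-- independent words.

geometricSum-suc : ∀ q k → geometricSum q (ℕ.suc k) ≡ geometricSum q k ℕ.+ q ℕ.^ k
geometricSum-suc q k = begin
  sum (map (q ℕ.^_) (upTo (ℕ.suc k)))         ≡⟨ ≡.cong (sum ∘ map (q ℕ.^_)) (applyUpTo-∷ʳ id k) ⟨
  sum (map (q ℕ.^_) (upTo k ∷ʳ k))            ≡⟨ ≡.cong sum (map-++ (q ℕ.^_) (upTo k) [ k ]) ⟩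
  sum (map (q ℕ.^_) (upTo k) ∷ʳ q ℕ.^ k)      ≡⟨ sum-++ (map (q ℕ.^_) (upTo k)) [ q ℕ.^ k ] ⟩
  geometricSum q k ℕ.+ (q ℕ.^ k ℕ.+ 0)        ≡⟨ ≡.cong (geometricSum q k ℕ.+_) (ℕₚ.+-identityʳ _) ⟩
  geometricSum q k ℕ.+ q ℕ.^ k                ∎
  where open ≡.≡-Reasoning

-- With q = p + 1 the classical identity is free of subtraction, and its left side has the shape of
-- a cone count: the origin plus p multiples per point.
geometricSum-closed : ∀ p k → ℕ.suc (geometricSum (ℕ.suc p) k * p) ≡ ℕ.suc p ℕ.^ k
geometricSum-closed p ℕ.zero    = ≡.refl
geometricSum-closed p (ℕ.suc k) = begin
  ℕ.suc (geometricSum q (ℕ.suc k) * p)    ≡⟨ ≡.cong (λ g → ℕ.suc (g * p)) (geometricSum-suc q k) ⟩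
  ℕ.suc ((G ℕ.+ q ℕ.^ k) * p)             ≡⟨ ≡.cong ℕ.suc (ℕₚ.*-distribʳ-+ p G (q ℕ.^ k)) ⟩
  ℕ.suc (G * p) ℕ.+ q ℕ.^ k * p           ≡⟨ ≡.cong (ℕ._+ q ℕ.^ k * p) (geometricSum-closed p k) ⟩
  q ℕ.^ k ℕ.+ q ℕ.^ k * p                 ≡⟨ ≡.cong (q ℕ.^ k ℕ.+_) (ℕₚ.*-comm (q ℕ.^ k) p) ⟩
  q ℕ.^ ℕ.suc k                           ∎
  where
  open ≡.≡-Reasoning
  q = ℕ.suc p
  G = geometricSum q k

^-cancelʳ-≤ : ∀ q {a b} → 2 ≤ q → q ℕ.^ a ≤ q ℕ.^ b → a ≤ b
^-cancelʳ-≤ q 2≤q qᵃ≤qᵇ = ℕₚ.≮⇒≥ λ b<a →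
  ℕₚ.<⇒≱ (ℕₚ.^-monoʳ-< q 2≤q b<a) qᵃ≤qᵇ

-- Enumerating and deciding subsets of a finite index set

element : ∀ {n} (S : Subset n) → Fin ∣ S ∣ → Fin n
element (inside  ∷ S) zero    = zero
element (inside  ∷ S) (suc i) = suc (element S i)
element (outside ∷ S) i       = suc (element S i)

element-∈ : ∀ {n} (S : Subset n) i → element S i ∈ₛ S
element-∈ (inside  ∷ S) zero    = here
element-∈ (inside  ∷ S) (suc i) = there (element-∈ S i)
element-∈ (outside ∷ S) i       = there (element-∈ S i)

element-injective : ∀ {n} (S : Subset n) → Injective _≡_ _≡_ (element S)
element-injective (inside  ∷ S) {zero}  {zero}  _  = ≡.refl
element-injective (inside  ∷ S) {suc i} {suc j} eq = ≡.cong suc (element-injective S (suc-injective eq))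
element-injective (outside ∷ S)                 eq = element-injective S (suc-injective eq)

element-surjective : ∀ {n} {S : Subset n} {k} → k ∈ₛ S → ∃[ i ] element S i ≡ k
element-surjective here = zero , ≡.refl
element-surjective {S = inside ∷ S} (there k∈S) with element-surjective k∈S
... | i , ≡.refl = suc i , ≡.refl
element-surjective {S = outside ∷ S} (there k∈S) with element-surjective k∈S
... | i , ≡.refl = i , ≡.refl

subset : ∀ {n a} {Q : Fin n → Set a} → Decidable Q → Subset n
subset Q? = tabulate (does ∘ Q?)

∈-subset : ∀ {n a} {Q : Fin n → Set a} (Q? : Decidable Q) i → i ∈ₛ subset Q? ⇔ Q i
∈-subset Q? i with Q? i | lookup∘tabulate (does ∘ Q?) i
... | yes Qi | eq = mk⇔ (λ _ → Qi) (λ _ → lookup⇒[]= i _ eq)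
... | no ¬Qi | eq = mk⇔
  (λ i∈S → contradiction (≡.trans (≡.sym ([]=⇒lookup i∈S)) eq) λ ())
  (λ Qi → contradiction Qi ¬Qi)

funToFin-cong : ∀ {m n} {f g : Fin m → Fin n} → f ≗ g → funToFin f ≡ funToFin g
funToFin-cong {ℕ.zero}  f≗g = ≡.refl
funToFin-cong {ℕ.suc m} f≗g = ≡.cong₂ combine (f≗g zero) (funToFin-cong (f≗g ∘ suc))

module FiniteField {c ℓ₁ ℓ₂} (F : HeytingField c ℓ₁ ℓ₂) (p : ℕ) (order : HasOrder F (ℕ.suc p)) where

  open HeytingField F hiding (zero) renaming (_*_ to _·_; _-_ to _−_)
  open OverField F
  open HeytingCommutativeRing heytingCommutativeRing using (commutativeRing)
  open CommutativeRing commutativeRing using (semiring; ring; *-commutativeSemigroup)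
  open SemiringSum semiring
    using (sum-syntax; sum-cong-≋; ∑-distrib-+; ∑-comm; *-distribˡ-sum; *-distribʳ-sum;
      sum-replicate-zero)
  open HeytingProperties heytingCommutativeRing using (x-0≈x; 1#0; invertibleˡ⇒#)
  open RingProperties ring
    using (-‿distribˡ-*; -‿distribʳ-*; x∙y⁻¹≈ε⇒x≈y; x≈y⇒x∙y⁻¹≈ε; +-inverseˡ-unique; -1*x≈-x)
  open CommutativeSemigroupProperties *-commutativeSemigroup using (x∙yz≈y∙xz)
  open VectorEquality setoid using (_≋_)
  import Relation.Binary.Reasoning.Setoid setoid as ≈-Reasoning

  private
    q : ℕ
    q = ℕ.suc p

  -- Decidability and nonzero scalars in a finite field

  open Inverse order using ()
    renaming (to to scalar; from to index; from-cong to index-cong;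
      strictlyInverseˡ to scalar-index; strictlyInverseʳ to index-scalar)

  index-injective : ∀ {x y} → index x ≡ index y → x ≈ y
  index-injective {x} {y} eq = trans (sym (scalar-index x)) (trans (reflexive (≡.cong scalar eq)) (scalar-index y))

  scalar-injective : ∀ {i j} → scalar i ≈ scalar j → i ≡ j
  scalar-injective {i} {j} eq = ≡.trans (≡.sym (index-scalar i)) (≡.trans (index-cong eq) (index-scalar j))

  _≟_ : ∀ x y → Dec (x ≈ y)
  x ≟ y = Dec.map′ index-injective index-cong (index x Fin.≟ index y)

  #⇒≉ : ∀ {x y} → x # y → ¬ (x ≈ y)
  #⇒≉ x#y x≈y = proj₂ (tight _ _) x≈y x#y

  #0⇒inverse : ∀ {x} → x # 0# → ∃[ y ] y · x ≈ 1#
  #0⇒inverse {x} x#0 with #⇒invertible x#0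
  ... | y , yx≈1 , _ = y , trans (*-congˡ (sym (x-0≈x x))) yx≈1

  inverse⇒#0 : ∀ {x y} → y · x ≈ 1# → x # 0#
  inverse⇒#0 {x} {y} yx≈1 = invertibleˡ⇒# (y , trans (*-congˡ (x-0≈x x)) yx≈1)

  inverse-cancels : ∀ {x x⁻¹} → x⁻¹ · x ≈ 1# → ∀ y → x⁻¹ · (x · y) ≈ y
  inverse-cancels x⁻¹x≈1 y = trans (sym (*-assoc _ _ _)) (trans (*-congʳ x⁻¹x≈1) (*-identityˡ y))

  #0-cancelˡ : ∀ {x y z} → x # 0# → x · y ≈ x · z → y ≈ z
  #0-cancelˡ x#0 xy≈xz with #0⇒inverse x#0
  ... | x⁻¹ , x⁻¹x≈1 = trans (sym (inverse-cancels x⁻¹x≈1 _)) (trans (*-congˡ xy≈xz) (inverse-cancels x⁻¹x≈1 _))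

  -- Tightness alone only gives ¬ ¬ (x # 0#), which is enough for multiplication
  -- by x to be injective; by finiteness 1# is then a multiple of x.
  ≉0⇒#0 : ∀ {x} → ¬ (x ≈ 0#) → x # 0#
  ≉0⇒#0 {x} x≉0 with any? (λ i → (scalar i · x) ≟ 1#)
  ... | yes (i , yx≈1) = inverse⇒#0 yx≈1
  ... | no  ∄y         = contradiction (injective⇒≤ f-injective) (ℕₚ.n≮n q)
    where
    cancel : ∀ {y z} → y · x ≈ z · x → y ≈ z
    cancel {y} {z} yx≈zx = decidable-stable (y ≟ z) λ y≉z → x≉0 (proj₁ (tight x 0#) λ x#0 →
      y≉z (#0-cancelˡ x#0 (trans (*-comm x y) (trans yx≈zx (*-comm z x)))))
    f : Fin (ℕ.suc q) → Fin q
    f zero    = index 1#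
    f (suc i) = index (scalar i · x)
    f-injective : Injective _≡_ _≡_ f
    f-injective {zero}  {zero}  _  = ≡.refl
    f-injective {zero}  {suc j} eq = contradiction (j , sym (index-injective eq)) ∄y
    f-injective {suc i} {zero}  eq = contradiction (i , index-injective eq) ∄y
    f-injective {suc i} {suc j} eq = ≡.cong suc (scalar-injective (cancel (index-injective eq)))

  _#0? : ∀ x → Dec (x # 0#)
  x #0? = Dec.map′ ≉0⇒#0 #⇒≉ (Dec.¬? (x ≟ 0#))

  ¬#0⇒≈0 : ∀ {x} → ¬ (x # 0#) → x ≈ 0#
  ¬#0⇒≈0 = proj₁ (tight _ _)

  -- `punchIn` skips exactly the index of zero, so `Fin p` numbers the p = q - 1 nonzero scalars.
  nonzero-scalar : Fin p → Carrier
  nonzero-scalar i = scalar (punchIn (index 0#) i)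

  nonzero-scalar-#0 : ∀ i → nonzero-scalar i # 0#
  nonzero-scalar-#0 i = ≉0⇒#0 λ ≈0 →
    punchInᵢ≢i (index 0#) i (≡.trans (≡.sym (index-scalar _)) (index-cong ≈0))

  nonzero-scalar-injective : ∀ {i j} → nonzero-scalar i ≈ nonzero-scalar j → i ≡ j
  nonzero-scalar-injective eq = punchIn-injective (index 0#) _ _ (scalar-injective eq)

  nonzero-scalar-surjective : ∀ {a} → a # 0# → ∃[ i ] nonzero-scalar i ≈ a
  nonzero-scalar-surjective {a} a#0 =
    punchOut 0≢a , trans (reflexive (≡.cong scalar (punchIn-punchOut 0≢a))) (scalar-index a)
    where
    0≢a : index 0# ≢ index a
    0≢a eq = #⇒≉ a#0 (sym (index-injective eq))

  -- The scalar `1#` is nonzero, so `Fin p` is inhabited. Hence q ≥ 2, which permits comparing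
  -- exponents of q and cancelling the factor p.
  1≤p : 1 ≤ p
  1≤p = ℕₚ.≤-<-trans ℕ.z≤n (toℕ<n (proj₁ (nonzero-scalar-surjective 1#0)))

  -- Linear algebra

  unit : ∀ {n} → Fin n → Vector Carrier n
  unit zero    zero    = 1#
  unit zero    (suc j) = 0#
  unit (suc i) zero    = 0#
  unit (suc i) (suc j) = unit i j

  unit-diag : ∀ {n} (i : Fin n) → unit i i ≈ 1#
  unit-diag zero    = refl
  unit-diag (suc i) = unit-diag i

  unit-off-diag : ∀ {n} {i j : Fin n} → i ≢ j → unit i j ≈ 0#
  unit-off-diag {i = zero}  {zero}  i≢j = contradiction ≡.refl i≢j
  unit-off-diag {i = zero}  {suc j} i≢j = refl
  unit-off-diag {i = suc i} {zero}  i≢j = refl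
  unit-off-diag {i = suc i} {suc j} i≢j = unit-off-diag (i≢j ∘ ≡.cong suc)

  unit-injection : ∀ {m n} {f : Fin m → Fin n} → Injective _≡_ _≡_ f →
                   ∀ i j → unit (f i) (f j) ≈ unit i j
  unit-injection {f = f} f-injective i j with i Fin.≟ j
  ... | yes ≡.refl = trans (unit-diag (f i)) (sym (unit-diag i))
  ... | no  i≢j    = trans (unit-off-diag (i≢j ∘ f-injective)) (sym (unit-off-diag i≢j))

  unit-symmetric : ∀ {n} (i j : Fin n) → unit i j ≈ unit j i
  unit-symmetric zero    zero    = refl
  unit-symmetric zero    (suc j) = refl
  unit-symmetric (suc i) zero    = refl
  unit-symmetric (suc i) (suc j) = unit-symmetric i j

  dot : ∀ {n} → Vector Carrier n → Vector Carrier n → Carrier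
  dot {n} x y = ∑[ i < n ] (x i · y i)

  dot-cong : ∀ {n} {x x′ y y′ : Vector Carrier n} → x ≋ x′ → y ≋ y′ → dot x y ≈ dot x′ y′
  dot-cong x≋x′ y≋y′ = sum-cong-≋ λ i → *-cong (x≋x′ i) (y≋y′ i)

  dot-comm : ∀ {n} (x y : Vector Carrier n) → dot x y ≈ dot y x
  dot-comm x y = sum-cong-≋ λ i → *-comm (x i) (y i)

  dot-zeroʳ : ∀ {n} (x : Vector Carrier n) {y} → y ≋ 0ᵛ → dot x y ≈ 0#
  dot-zeroʳ {n} x y≋0 =
    trans (sum-cong-≋ λ i → trans (*-congˡ (y≋0 i)) (zeroʳ (x i))) (sum-replicate-zero n)

  dot-+ʳ : ∀ {n} (x y z : Vector Carrier n) → dot x (y +ᵛ z) ≈ dot x y + dot x z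
  dot-+ʳ x y z =
    trans (sum-cong-≋ λ i → distribˡ (x i) (y i) (z i)) (∑-distrib-+ (λ i → x i · y i) (λ i → x i · z i))

  dot-*ʳ : ∀ {n} a (x y : Vector Carrier n) → dot x (a *ᵛ y) ≈ a · dot x y
  dot-*ʳ a x y = trans (sum-cong-≋ λ i → x∙yz≈y∙xz (x i) a (y i)) (sym (*-distribˡ-sum a (λ i → x i · y i)))

  dot-unit : ∀ {n} (i : Fin n) (x : Vector Carrier n) → dot (unit i) x ≈ x i
  dot-unit zero    x = trans
    (+-cong (*-identityˡ _) (trans (dot-comm 0ᵛ (tail x)) (dot-zeroʳ (tail x) λ _ → refl)))
    (+-identityʳ _)
  dot-unit (suc i) x = trans (+-cong (zeroˡ _) (dot-unit i (tail x))) (+-identityˡ _)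

  dot-unit-injection : ∀ {m n} {f : Fin m → Fin n} → Injective _≡_ _≡_ f → ∀ a j →
                       dot a (λ i → unit (f i) (f j)) ≈ a j
  dot-unit-injection {f = f} f-injective a j = begin
    dot a (λ i → unit (f i) (f j))  ≈⟨ sum-cong-≋ (λ i → *-congˡ {a i} (trans (unit-injection f-injective i j) (unit-symmetric i j))) ⟩
    dot a (unit j)                  ≈⟨ dot-comm a (unit j) ⟩
    dot (unit j) a                  ≈⟨ dot-unit j a ⟩
    a j                             ∎
    where open ≈-Reasoning

  dot-combination : ∀ {n k} (a : Vector Carrier k) (v : Vector (Vector Carrier n) k) x →
                    dot (combination a v) x ≈ dot a (λ j → dot (v j) x)
  dot-combination {n} {k} a v x = begin
    ∑[ i < n ] ((∑[ j < k ] (a j · v j i)) · x i)  ≈⟨ sum-cong-≋ (λ i → *-distribʳ-sum (x i) (λ j → a j · v j i)) ⟩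
    ∑[ i < n ] ∑[ j < k ] (a j · v j i · x i)      ≈⟨ ∑-comm (λ i j → a j · v j i · x i) ⟩
    ∑[ j < k ] ∑[ i < n ] (a j · v j i · x i)      ≈⟨ sum-cong-≋ (λ j → sum-cong-≋ λ i → *-assoc (a j) (v j i) (x i)) ⟩
    ∑[ j < k ] ∑[ i < n ] (a j · (v j i · x i))    ≈⟨ sum-cong-≋ (λ j → *-distribˡ-sum (a j) (λ i → v j i · x i)) ⟨
    ∑[ j < k ] (a j · dot (v j) x)                 ∎
    where open ≈-Reasoning

  infixl 6 _-ᵛ_
  -- Spelled as a sum with a scalar multiple, so that the linearity lemmas for `dot` apply directly.
  _-ᵛ_ : ∀ {n} → Vector Carrier n → Vector Carrier n → Vector Carrier n
  x -ᵛ y = x +ᵛ ((- 1#) *ᵛ y)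

  -ᵛ-≈ : ∀ {n} (x y : Vector Carrier n) i → (x -ᵛ y) i ≈ x i − y i
  -ᵛ-≈ x y i = +-congˡ (-1*x≈-x (y i))

  -ᵛ≋0⇒≋ : ∀ {n} {x y : Vector Carrier n} → x -ᵛ y ≋ 0ᵛ → x ≋ y
  -ᵛ≋0⇒≋ {x = x} {y} x-y≋0 i = x∙y⁻¹≈ε⇒x≈y (x i) (y i) (trans (sym (-ᵛ-≈ x y i)) (x-y≋0 i))

  dot-−ʳ : ∀ {n} (x y z : Vector Carrier n) → dot x (y -ᵛ z) ≈ dot x y − dot x z
  dot-−ʳ x y z = trans (dot-+ʳ x y _) (+-congˡ (trans (dot-*ʳ (- 1#) x z) (-1*x≈-x _)))

  dot-equal : ∀ {n} (x : Vector Carrier n) {y z} → dot x y ≈ dot x z → dot x (y -ᵛ z) ≈ 0#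
  dot-equal x {y} {z} eq = trans (dot-−ʳ x y z) (x≈y⇒x∙y⁻¹≈ε eq)

  -- A coordinate of `combination a v` unfolds to `dot a (λ j → v j i)`, so closure is linearity of
  -- `dot` in its first argument.
  spanned : ∀ {n k} → Vector (Vector Carrier n) k → Subspace n
  spanned v = record
    { member   = Span v
    ; resp     = λ x≋y (a , x≋av) → a , λ i → trans (sym (x≋y i)) (x≋av i)
    ; 0-closed = 0ᵛ , λ i → sym (trans (dot-comm 0ᵛ (λ j → v j i)) (dot-zeroʳ (λ j → v j i) λ _ → refl))
    ; +-closed = λ (a , x≋av) (b , y≋bv) → a +ᵛ b , λ i →
        trans (+-cong (x≋av i) (y≋bv i)) (sym (dot-+ˡ a b (λ j → v j i)))
    ; *-closed = λ a (b , x≋bv) → a *ᵛ b , λ i →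
        trans (*-congˡ (x≋bv i)) (sym (dot-*ˡ a b (λ j → v j i)))
    }
    where
    dot-+ˡ : ∀ {n} (x y z : Vector Carrier n) → dot (x +ᵛ y) z ≈ dot x z + dot y z
    dot-+ˡ x y z = trans (dot-comm _ z) (trans (dot-+ʳ z x y) (+-cong (dot-comm z x) (dot-comm z y)))
    dot-*ˡ : ∀ {n} a (x y : Vector Carrier n) → dot (a *ᵛ x) y ≈ a · dot x y
    dot-*ˡ a x y = trans (dot-comm _ y) (trans (dot-*ʳ a y x) (*-congˡ (dot-comm y x)))

  combination-closed : ∀ {n k} (D : Subspace n) (a : Vector Carrier k) {v} →
                       (∀ j → v j ∈ member D) → combination a v ∈ member D
  combination-closed {k = ℕ.zero}  D a v∈D = Subspace.0-closed D
  combination-closed {k = ℕ.suc k} D a v∈D = Subspace.+-closed D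
    (Subspace.*-closed D (a zero) (v∈D zero)) (combination-closed D (tail a) (v∈D ∘ suc))

  span-⊆ : ∀ {n k} (D : Subspace n) (v : Vector (Vector Carrier n) k) →
           (∀ j → v j ∈ member D) → Span v ⊆ member D
  span-⊆ D v v∈D (a , x≋av) = Subspace.resp D (λ i → sym (x≋av i)) (combination-closed D a v∈D)

  ∈-span : ∀ {n k} (v : Vector (Vector Carrier n) k) j → v j ∈ Span v
  ∈-span v j = unit j , λ i → sym (dot-unit j (λ j′ → v j′ i))

  combination-injective : ∀ {n k} {v : Vector (Vector Carrier n) k} → LinearlyIndependent v →
                          ∀ {a b} → combination a v ≋ combination b v → a ≋ b
  combination-injective {v = v} independent {a} {b} av≋bv = -ᵛ≋0⇒≋ (independent (a -ᵛ b) λ i →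
    trans (dot-comm _ (λ j → v j i)) (dot-equal (λ j → v j i)
      (trans (dot-comm _ a) (trans (av≋bv i) (dot-comm b _)))))

  -- In a relation on `w ∷ᵛ v` a nonzero leading coefficient could be inverted, which would solve
  -- for `w` in terms of `v`.
  ∷-independent : ∀ {n k} {v : Vector (Vector Carrier n) k} {w} →
                  LinearlyIndependent v → ¬ (w ∈ Span v) → LinearlyIndependent (w ∷ᵛ v)
  ∷-independent {v = v} {w} independent w∉v a aw∷v≋0 with a zero ≟ 0#
  ... | yes a₀≈0 = λ where
    zero    → a₀≈0
    (suc j) → independent (tail a) (λ i →
      trans (sym (trans (+-congʳ (trans (*-congʳ a₀≈0) (zeroˡ (w i)))) (+-identityˡ _))) (aw∷v≋0 i)) j
  ... | no a₀≉0 with #0⇒inverse (≉0⇒#0 a₀≉0)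
  ...   | b , ba₀≈1 = contradiction (Subspace.resp (spanned v) w≋
                        (Subspace.*-closed (spanned v) (- b) (combination-closed (spanned v) (tail a) (∈-span v)))) w∉v
    where
    w≋ : (- b) *ᵛ combination (tail a) v ≋ w
    w≋ i = begin
      - b · r            ≈⟨ -‿distribˡ-* b r ⟨
      - (b · r)          ≈⟨ -‿distribʳ-* b r ⟩
      b · (- r)          ≈⟨ *-congˡ (+-inverseˡ-unique _ r (aw∷v≋0 i)) ⟨
      b · (a zero · w i) ≈⟨ inverse-cancels ba₀≈1 (w i) ⟩
      w i                ∎
      where
      open ≈-Reasoning
      r = combination (tail a) v i

  -- Counting vectors

  -- Together with `code` this numbers F^n by q^n indices, so that dimension and point counts become
  -- injections between `Fin` types.
  vector : ∀ {n} → Fin (q ℕ.^ n) → Vector Carrier n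
  vector i = scalar ∘ finToFun i

  code : ∀ {n} → Vector Carrier n → Fin (q ℕ.^ n)
  code x = funToFin (index ∘ x)

  vector-code : ∀ {n} (x : Vector Carrier n) → vector (code x) ≋ x
  vector-code x i = trans (reflexive (≡.cong scalar (finToFun-funToFin (index ∘ x) i))) (scalar-index (x i))

  code-cong : ∀ {n} {x y : Vector Carrier n} → x ≋ y → code x ≡ code y
  code-cong x≋y = funToFin-cong (index-cong ∘ x≋y)

  code-injective : ∀ {n} {x y : Vector Carrier n} → code x ≡ code y → x ≋ y
  code-injective {x = x} {y} eq i =
    trans (sym (vector-code x i)) (trans (reflexive (≡.cong (λ k → vector k i) eq)) (vector-code y i))

  code-vector : ∀ {n} (i : Fin (q ℕ.^ n)) → code (vector {n} i) ≡ i
  code-vector {n} i = ≡.trans (funToFin-cong {n} (index-scalar ∘ finToFun i)) (funToFin-finToFin {n} i)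

  vector-injective : ∀ {n} {i j : Fin (q ℕ.^ n)} → vector {n} i ≋ vector j → i ≡ j
  vector-injective {n} {i} {j} eq = ≡.trans (≡.sym (code-vector {n} i)) (≡.trans (code-cong eq) (code-vector {n} j))

  -- Counting replaces elimination: the q^k combinations are pairwise distinct among q^n vectors.
  independent⇒≤ : ∀ {n k} {v : Vector (Vector Carrier n) k} → LinearlyIndependent v → k ≤ n
  independent⇒≤ {n} {k} {v} independent = ^-cancelʳ-≤ q (ℕ.s≤s 1≤p)
    (injective⇒≤ {f = λ i → code (combination (vector {k} i) v)} λ eq →
      vector-injective {k} (combination-injective {v = v} independent (code-injective eq)))

  -- Exhaustive search over the q^k coefficient vectors. It drives the greedy choices in
  -- `span-basis` and `complement`.
  _∈span?_ : ∀ {n k} (x : Vector Carrier n) (v : Vector (Vector Carrier n) k) → Dec (x ∈ Span v)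
  _∈span?_ {n} {k} x v = Dec.map′
    (λ (i , x≋av) → vector {k} i , x≋av)
    (λ (a , x≋av) → code a , λ i → trans (x≋av i) (sym (dot-cong {y = λ j → v j i} (vector-code a) (λ _ → refl))))
    (any? λ a → all? λ i → x i ≟ combination (vector {k} a) v i)

  -- Greedy selection: a vector is kept only if it lies outside the span of those kept from the
  -- tail. This supplies the row-space basis that `Rank≤` asks for.
  span-basis : ∀ {n k} (v : Vector (Vector Carrier n) k) → ∃[ r ] HasDimension (Span v) r × r ≤ k
  span-basis {k = ℕ.zero}  v = 0 , (v , (λ _ _ ()) , id , id) , ℕ.z≤n
  span-basis {k = ℕ.suc k} v with span-basis (tail v)
  ... | r , (b , independent , v⊆b , b⊆v) , r≤k with v zero ∈span? b
  ...   | yes v₀∈b = r , (b , independent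
                         , span-⊆ (spanned b) v (λ where
                             zero    → v₀∈b
                             (suc j) → v⊆b (∈-span (tail v) j))
                         , λ x∈b → span-⊆ (spanned v) (tail v) (∈-span v ∘ suc) (b⊆v x∈b)) , ℕₚ.m≤n⇒m≤1+n r≤k
  ...   | no  v₀∉b = ℕ.suc r , (v₀∷b , ∷-independent {v = b} {v zero} independent v₀∉b
                         , span-⊆ (spanned v₀∷b) v (λ where
                             zero    → ∈-span v₀∷b zero
                             (suc j) → span-⊆ (spanned v₀∷b) b (∈-span v₀∷b ∘ suc) (v⊆b (∈-span (tail v) j)))
                         , span-⊆ (spanned v) v₀∷b (λ where
                             zero    → ∈-span v zero
                             (suc j) → span-⊆ (spanned v) (tail v) (∈-span v ∘ suc) (b⊆v (∈-span b j)))) , ℕ.s≤s r≤k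
    where v₀∷b = v zero ∷ᵛ b

  -- Extending v by unit vectors to a spanning family bounds the codimension of
  -- its annihilator without computing any rank.
  complement : ∀ {n s} r (v : Vector (Vector Carrier n) s) → LinearlyIndependent v → n ≤ s ℕ.+ r →
               Σ[ w ∈ Vector (Vector Carrier n) r ]
                 (∀ x → (∀ j → dot (v j) x ≈ 0#) → (∀ j → dot (w j) x ≈ 0#) → x ≋ 0ᵛ)
  complement {n} {s} r v independent n≤s+r with all? (λ i → unit i ∈span? v)
  -- Here `v` alone already separates vectors, so zero vectors pad `w` to length r.
  ... | yes unit∈v = (λ _ → 0ᵛ) , λ x v⊥x _ i → let (a , uᵢ≋av) = unit∈v i in begin
      x i                          ≈⟨ dot-unit i x ⟨
      dot (unit i) x               ≈⟨ dot-cong uᵢ≋av (λ _ → refl) ⟩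
      dot (combination a v) x      ≈⟨ dot-combination a v x ⟩
      dot a (λ j → dot (v j) x)    ≈⟨ dot-zeroʳ a v⊥x ⟩
      0#                           ∎
    where open ≈-Reasoning
  ... | no unit∉v with ¬∀⟶∃¬ n _ (λ i → unit i ∈span? v) unit∉v
  ...   | i , uᵢ∉v with r
  ...     | ℕ.zero  = contradiction
                        (ℕₚ.≤-trans
                          (independent⇒≤ {v = unit i ∷ᵛ v} (∷-independent {v = v} {unit i} independent uᵢ∉v))
                          (ℕₚ.≤-trans n≤s+r (ℕₚ.≤-reflexive (ℕₚ.+-identityʳ s))))
                        (ℕₚ.n≮n s)
  ...     | ℕ.suc r′ with complement r′ (unit i ∷ᵛ v) (∷-independent {v = v} {unit i} independent uᵢ∉v)
                                     (ℕₚ.≤-trans n≤s+r (ℕₚ.≤-reflexive (ℕₚ.+-suc s r′)))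
  ...       | w , separates = unit i ∷ᵛ w , λ x v⊥x w⊥x →
                separates x (λ where
                  zero    → w⊥x zero
                  (suc j) → v⊥x j) (w⊥x ∘ suc)

  -- Projective points

  module Points {N n} (P : Fin n → Vector Carrier N)
    (nonzero : ∀ k → ∃[ i ] P k i # 0#)
    (distinct : ∀ {k k′ a} → a # 0# → P k ≋ a *ᵛ P k′ → k ≡ k′) where

    multiple : ∀ (S : Subset n) → Fin ∣ S ∣ × Fin p → Vector Carrier N
    multiple S (j , a) = nonzero-scalar a *ᵛ P (element S j)

    multiple-≉0 : ∀ S i → ¬ (multiple S i ≋ 0ᵛ)
    multiple-≉0 S (j , a) aP≋0 with nonzero (element S j)
    ... | l , Pₗ#0 = #⇒≉ Pₗ#0 (#0-cancelˡ (nonzero-scalar-#0 a) (trans (aP≋0 l) (sym (zeroʳ _))))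

    scaled-injective : ∀ {k k′ a b} → a # 0# → b # 0# → a *ᵛ P k ≋ b *ᵛ P k′ → k ≡ k′ × a ≈ b
    scaled-injective {k} {k′} {a} {b} a#0 b#0 aP≋bP = k≡k′ , a≈b k≡k′
      where
      open ≈-Reasoning
      k≡k′ : k ≡ k′
      k≡k′ with #0⇒inverse a#0 | #0⇒inverse b#0
      -- The two points differ by the ratio `a⁻¹ · b`, which is nonzero because `a · b⁻¹` is its
      -- inverse.
      ... | a⁻¹ , a⁻¹a≈1 | b⁻¹ , b⁻¹b≈1 = distinct {a = a⁻¹ · b} (inverse⇒#0 {y = a · b⁻¹} inv) λ i →
        trans (sym (inverse-cancels a⁻¹a≈1 (P k i))) (trans (*-congˡ (aP≋bP i)) (sym (*-assoc _ _ _)))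
        where
        inv : a · b⁻¹ · (a⁻¹ · b) ≈ 1#
        inv = begin
          a · b⁻¹ · (a⁻¹ · b)    ≈⟨ *-comm _ _ ⟩
          a⁻¹ · b · (a · b⁻¹)    ≈⟨ *-assoc _ _ _ ⟩
          a⁻¹ · (b · (a · b⁻¹))  ≈⟨ *-congˡ (x∙yz≈y∙xz b a b⁻¹) ⟩
          a⁻¹ · (a · (b · b⁻¹))  ≈⟨ inverse-cancels a⁻¹a≈1 _ ⟩
          b · b⁻¹                ≈⟨ *-comm b b⁻¹ ⟩
          b⁻¹ · b                ≈⟨ b⁻¹b≈1 ⟩
          1#                     ∎
      a≈b : k ≡ k′ → a ≈ b
      a≈b ≡.refl with nonzero k
      -- Once the points agree, a nonzero coordinate of the common point can be cancelled.
      ... | i , Pᵢ#0 = #0-cancelˡ Pᵢ#0 (trans (*-comm _ a) (trans (aP≋bP i) (*-comm b _)))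

    multiple-injective : ∀ S {i i′} → multiple S i ≋ multiple S i′ → i ≡ i′
    multiple-injective S {j , a} {j′ , a′} eq with scaled-injective (nonzero-scalar-#0 a) (nonzero-scalar-#0 a′) eq
    ... | k≡k′ , a≈a′ = ≡.cong₂ _,_ (element-injective S k≡k′) (nonzero-scalar-injective a≈a′)

    multiple-surjective : ∀ S {k a} → k ∈ₛ S → a # 0# → ∃[ i ] multiple S i ≋ a *ᵛ P k
    multiple-surjective S k∈S a#0 with element-surjective k∈S | nonzero-scalar-surjective a#0
    ... | j , ≡.refl | b , b≈a = (j , b) , λ l → *-congʳ b≈a

    -- The affine cone over `S`. The extra index is the origin, which makes the cone comparable with
    -- a whole vector space.
    cone : ∀ (S : Subset n) → Fin (ℕ.suc (∣ S ∣ * p)) → Vector Carrier N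
    cone S zero    = 0ᵛ
    cone S (suc i) = multiple S (remQuot p i)

    cone-injective : ∀ S {i i′} → cone S i ≋ cone S i′ → i ≡ i′
    cone-injective S {zero}  {zero}   eq = ≡.refl
    cone-injective S {zero}  {suc i′} eq = contradiction (λ l → sym (eq l)) (multiple-≉0 S (remQuot p i′))
    cone-injective S {suc i} {zero}   eq = contradiction eq (multiple-≉0 S (remQuot p i))
    cone-injective S {suc i} {suc i′} eq = ≡.cong suc (begin
      i                                       ≡⟨ combine-remQuot {∣ S ∣} p i ⟨
      uncurry combine (remQuot {∣ S ∣} p i)   ≡⟨ ≡.cong (uncurry combine) (multiple-injective S eq) ⟩
      uncurry combine (remQuot {∣ S ∣} p i′)  ≡⟨ combine-remQuot {∣ S ∣} p i′ ⟩
      i′                                      ∎)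
      where open ≡.≡-Reasoning

    cone-surjective : ∀ S {k a} → k ∈ₛ S → a # 0# → ∃[ i ] cone S i ≋ a *ᵛ P k
    cone-surjective S k∈S a#0 with multiple-surjective S k∈S a#0
    ... | (j , b) , eq = suc (combine j b) , λ l →
      trans (reflexive (≡.cong (λ i → multiple S i l) (remQuot-combine j b))) (eq l)

    cone-annihilated : ∀ S x → (∀ {k} → k ∈ₛ S → dot x (P k) ≈ 0#) → ∀ i → dot x (cone S i) ≈ 0#
    cone-annihilated S x x⊥S zero    = dot-zeroʳ x λ _ → refl
    cone-annihilated S x x⊥S (suc i) = let (j , a) = remQuot {∣ S ∣} p i in
      trans (dot-*ʳ (nonzero-scalar a) x (P (element S j))) (trans (*-congˡ (x⊥S (element-∈ S j))) (zeroʳ _))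

    -- All of `v` vanishes on the cone over `S`, so the r functionals of `complement` alone must
    -- tell its vectors apart: a difference killed by both families is zero. The cone thus injects
    -- into F^r.
    annihilated-≤ : ∀ {s} r S (v : Vector (Vector Carrier N) s) → LinearlyIndependent v → N ≤ s ℕ.+ r →
                    (∀ j {k} → k ∈ₛ S → dot (v j) (P k) ≈ 0#) → ∣ S ∣ ≤ geometricSum q r
    annihilated-≤ r S v independent N≤s+r v⊥S with complement r v independent N≤s+r
    ... | w , separates = ℕₚ.*-cancelʳ-≤ _ _ p {{ℕ.>-nonZero 1≤p}} (ℕ.s≤s⁻¹
          (≡.subst (ℕ.suc (∣ S ∣ * p) ≤_) (≡.sym (geometricSum-closed p r)) (injective⇒≤ {f = f} f-injective)))
      where
      f : Fin (ℕ.suc (∣ S ∣ * p)) → Fin (q ℕ.^ r)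
      f i = code (λ j → dot (w j) (cone S i))
      f-injective : Injective _≡_ _≡_ f
      f-injective {i} {i′} eq = cone-injective S (-ᵛ≋0⇒≋ (separates (cone S i -ᵛ cone S i′)
        (λ j → dot-equal (v j) (trans (cone-annihilated S (v j) (v⊥S j) i) (sym (cone-annihilated S (v j) (v⊥S j) i′))))
        (λ j → dot-equal (w j) (code-injective eq j))))

    -- The reverse injection: the q^r combinations of `w` are distinct and all lie in the cone over
    -- `S`. Only nonzero ones call on the hypothesis, since zero is the origin of the cone.
    contained-≥ : ∀ {r} S (w : Vector (Vector Carrier N) r) → LinearlyIndependent w →
                  (∀ {x i} → x ∈ Span w → x i # 0# → ∃₂ λ k a → k ∈ₛ S × a # 0# × x ≋ a *ᵛ P k) →
                  geometricSum q r ≤ ∣ S ∣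
    contained-≥ {r} S w independent contained = ℕₚ.*-cancelʳ-≤ _ _ p {{ℕ.>-nonZero 1≤p}} (ℕ.s≤s⁻¹
        (≡.subst (_≤ ℕ.suc (∣ S ∣ * p)) (≡.sym (geometricSum-closed p r)) (injective⇒≤ {f = f} f-injective)))
      where
      in-cone : ∀ {x} → x ∈ Span w → ∃[ i ] cone S i ≋ x
      in-cone {x} x∈w with any? (λ i → x i #0?)
      ... | no  x≋0      = zero , λ i → sym (¬#0⇒≈0 (x≋0 ∘ (i ,_)))
      ... | yes (i , xᵢ#0) with contained x∈w xᵢ#0
      ...   | k , a , k∈S , a#0 , x≋aPₖ with cone-surjective S k∈S a#0
      ...     | j , eq = j , λ l → trans (eq l) (sym (x≋aPₖ l))
      in-span : Fin (q ℕ.^ r) → Vector Carrier N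
      in-span i = combination (vector {r} i) w
      f : Fin (q ℕ.^ r) → Fin (ℕ.suc (∣ S ∣ * p))
      f i = proj₁ (in-cone {in-span i} (vector {r} i , λ _ → refl))
      cone-f : ∀ i → cone S (f i) ≋ in-span i
      cone-f i = proj₂ (in-cone {in-span i} (vector {r} i , λ _ → refl))
      f-injective : Injective _≡_ _≡_ f
      f-injective {i} {j} eq = vector-injective {r} (combination-injective {v = w} independent λ l →
        trans (sym (cone-f i l)) (trans (reflexive (≡.cong (λ h → cone S h l) eq)) (cone-f j l)))

  -- Matrices as vectors of length ℓ * m

  flatten : ∀ {ℓ m} → Matrix ℓ m → Vector Carrier (ℓ * m)
  flatten {ℓ} {m} M i = uncurry M (remQuot {ℓ} m i)

  unflatten : ∀ {ℓ m} → Vector Carrier (ℓ * m) → Matrix ℓ m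
  unflatten x i j = x (combine i j)

  flatten-unflatten : ∀ {ℓ m} (x : Vector Carrier (ℓ * m)) → flatten {ℓ} {m} (unflatten x) ≋ x
  flatten-unflatten {ℓ} {m} x i = reflexive (≡.cong x (combine-remQuot {ℓ} m i))

  unflatten-flatten : ∀ {ℓ m} (M : Matrix ℓ m) i j → flatten M (combine i j) ≈ M i j
  unflatten-flatten M i j = reflexive (≡.cong (uncurry M) (remQuot-combine i j))

  sum-+ : ∀ m {n} (x : Vector Carrier (m ℕ.+ n)) →
          ∑[ i < m ℕ.+ n ] x i ≈ ∑[ i < m ] x (i ↑ˡ n) + ∑[ i < n ] x (m ↑ʳ i)
  sum-+ ℕ.zero    x = sym (+-identityˡ _)
  sum-+ (ℕ.suc m) x = trans (+-congˡ (sum-+ m (tail x))) (sym (+-assoc _ _ _))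

  sum-combine : ∀ ℓ {m} (x : Vector Carrier (ℓ * m)) →
                ∑[ i < ℓ * m ] x i ≈ ∑[ i < ℓ ] ∑[ j < m ] x (combine i j)
  sum-combine ℕ.zero    x = refl
  sum-combine (ℕ.suc ℓ) {m} x = trans (sum-+ m x) (+-congˡ (sum-combine ℓ (λ i → x (m ↑ʳ i))))

  linearForm-flatten : ∀ {ℓ m} (A M : Matrix ℓ m) → linearForm A M ≈ dot (flatten A) (flatten M)
  linearForm-flatten {ℓ} {m} A M = sym (trans (sum-combine ℓ (λ i → flatten A i · flatten M i))
    (sum-cong-≋ λ i → sum-cong-≋ λ j → *-cong (unflatten-flatten A i j) (unflatten-flatten M i j)))

  -- The rows picked by `ρ` span the row space because all other rows vanish, and a basis chosen
  -- among k vectors has at most k elements.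
  rank≤-rows : ∀ {ℓ m k} (M : Matrix ℓ m) (ρ : Fin k → Fin ℓ) →
               (∀ i → (∃[ j ] ρ j ≡ i) ⊎ M i ≋ 0ᵛ) → Rank≤ k M
  rank≤-rows {ℓ} {m} {k} M ρ rows with span-basis (M ∘ ρ)
  ... | r , (b , independent , ρ⊆b , b⊆ρ) , r≤k = r , (b , independent
      , (λ x∈M → ρ⊆b (span-⊆ (spanned (M ∘ ρ)) M M∈ρ x∈M))
      , λ x∈b → span-⊆ (spanned M) (M ∘ ρ) (∈-span M ∘ ρ) (b⊆ρ x∈b)) , r≤k
    where
    M∈ρ : ∀ i → M i ∈ Span (M ∘ ρ)
    M∈ρ i with rows i
    ... | inj₁ (j , ≡.refl) = ∈-span (M ∘ ρ) j
    ... | inj₂ Mᵢ≋0         = Subspace.resp (spanned (M ∘ ρ)) (λ l → sym (Mᵢ≋0 l)) (Subspace.0-closed (spanned (M ∘ ρ)))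

  -- Evaluation at the points of the determinantal variety

  module Code {t ℓ m n̂} (1≤t : 1 ≤ t) (t≤ℓ : t ≤ ℓ) (points : Enumeration t ℓ m n̂) where

    open Inverse points using ()
      renaming (to to point; from to position; from-cong to position-cong;
        strictlyInverseˡ to point-position; strictlyInverseʳ to position-point)

    P : Fin n̂ → Vector Carrier (ℓ * m)
    P k = flatten (representative points k)

    P-nonzero : ∀ k → ∃[ i ] P k i # 0#
    P-nonzero k with point k
    ... | M , (i , j , Mᵢⱼ#0) , _ =
      combine i j , ≉0⇒#0 λ ≈0 → #⇒≉ Mᵢⱼ#0 (trans (sym (unflatten-flatten M i j)) ≈0)

    P-distinct : ∀ {k k′ a} → a # 0# → P k ≋ a *ᵛ P k′ → k ≡ k′
    P-distinct {k} {k′} {a} a#0 Pₖ≋aPₖ′ =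
      ≡.trans (≡.sym (position-point k)) (≡.trans (position-cong {point k} {point k′} proportional) (position-point k′))
      where
      proportional : Proportional (representative points k) (representative points k′)
      proportional = a , a#0 , λ i j →
        trans (sym (unflatten-flatten (representative points k) i j))
          (trans (Pₖ≋aPₖ′ (combine i j)) (*-congˡ (unflatten-flatten (representative points k′) i j)))

    -- Surjectivity of the enumeration, recast as scalar multiples of the chosen representatives,
    -- which is the form `contained-≥` consumes.
    P-complete : ∀ {x i} → x i # 0# → Rank≤ t (unflatten {ℓ} {m} x) →
                 ∃₂ λ k a → a # 0# × x ≋ a *ᵛ P k
    P-complete {x} {i} xᵢ#0 rank≤t =
      let (a , a#0 , x≈aP) = proportional-sym (point-position pt) in
      position pt , a , a#0 , λ i →
        trans (sym (flatten-unflatten {ℓ} {m} x i)) (uncurry x≈aP (remQuot {ℓ} m i))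
      where
      pt : Setoid.Carrier (DeterminantalVariety t ℓ m)
      pt = unflatten x
         , (proj₁ (remQuot {ℓ} m i) , proj₂ (remQuot {ℓ} m i) , ≉0⇒#0 λ ≈0 →
             #⇒≉ xᵢ#0 (trans (sym (flatten-unflatten {ℓ} {m} x i)) ≈0))
         , rank≤t

    open Points P P-nonzero P-distinct

    -- A matrix unit has a single row that can be nonzero; the hypothesis 1 ≤ t enters here.
    unit-rank≤ : ∀ i → Rank≤ t (unflatten {ℓ} {m} (unit i))
    unit-rank≤ i = map₂ (map₂ λ r≤1 → ℕₚ.≤-trans r≤1 1≤t) (rank≤-rows (unflatten (unit i)) (λ _ → row) rows)
      where
      row : Fin ℓ
      row = proj₁ (remQuot {ℓ} m i)
      rows : ∀ i′ → (∃[ j ] row ≡ i′) ⊎ unflatten {ℓ} {m} (unit i) i′ ≋ 0ᵛ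
      rows i′ with row Fin.≟ i′
      ... | yes row≡i′ = inj₁ (zero , row≡i′)
      ... | no  row≢i′ = inj₂ λ j → unit-off-diag λ i≡i′j →
        row≢i′ (≡.cong proj₁ (≡.trans (≡.cong (remQuot m) i≡i′j) (remQuot-combine i′ j)))

    unit-complete : ∀ i → ∃₂ λ k a → a # 0# × unit i ≋ a *ᵛ P k
    unit-complete i = P-complete {i = i} (inverse⇒#0 (trans (*-identityˡ _) (unit-diag i))) (unit-rank≤ i)

    -- Evaluating a relation at the point proportional to the matrix unit of entry `f j` isolates
    -- the coefficient `a j`. For all entries at once this says that the code has dimension ℓm.
    coordinates-independent : ∀ {s} {f : Fin s → Fin (ℓ * m)} → Injective _≡_ _≡_ f →
                              LinearlyIndependent (λ j k → P k (f j))
    coordinates-independent {f = f} f-injective a aP≋0 j = let (k , b , _ , u≋bP) = unit-complete (f j) in begin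
      a j                             ≈⟨ dot-unit-injection f-injective a j ⟨
      dot a (λ i → unit (f i) (f j))  ≈⟨ sum-cong-≋ (λ i → *-congˡ {a i} (trans (unit-symmetric (f i) (f j)) (u≋bP (f i)))) ⟩
      dot a (b *ᵛ (λ i → P k (f i)))  ≈⟨ dot-*ʳ b a (λ i → P k (f i)) ⟩
      b · dot a (λ i → P k (f i))     ≈⟨ *-congˡ (aP≋0 k) ⟩
      b · 0#                          ≈⟨ zeroʳ b ⟩
      0#                              ∎
      where open ≈-Reasoning

    -- Extremal subcode and comparison of zero counts

    module Weight {s r} (r+s≡ℓm : r ℕ.+ s ≡ ℓ * m) (r≤tm : r ≤ t * m) where

      low : Fin r → Fin (ℓ * m)
      low j = cast r+s≡ℓm (j ↑ˡ s)

      high : Fin s → Fin (ℓ * m)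
      high j = cast r+s≡ℓm (r ↑ʳ j)

      toℕ-low : ∀ j → toℕ (low j) ≡ toℕ j
      toℕ-low j = ≡.trans (toℕ-cast r+s≡ℓm (j ↑ˡ s)) (toℕ-↑ˡ j s)

      toℕ-high : ∀ j → toℕ (high j) ≡ r ℕ.+ toℕ j
      toℕ-high j = ≡.trans (toℕ-cast r+s≡ℓm (r ↑ʳ j)) (toℕ-↑ʳ r j)

      low-injective : Injective _≡_ _≡_ low
      low-injective {i} {j} eq =
        toℕ-injective (≡.trans (≡.sym (toℕ-low i)) (≡.trans (≡.cong toℕ eq) (toℕ-low j)))

      high-injective : Injective _≡_ _≡_ high
      high-injective {i} {j} eq = toℕ-injective (ℕₚ.+-cancelˡ-≡ r _ _
        (≡.trans (≡.sym (toℕ-high i)) (≡.trans (≡.cong toℕ eq) (toℕ-high j))))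

      low-units : Vector (Vector Carrier (ℓ * m)) r
      low-units j = unit (low j)

      low-independent : LinearlyIndependent low-units
      low-independent a au≋0 j = trans (sym (dot-unit-injection low-injective a j)) (au≋0 (low j))

      low-support : ∀ {x i} → x ∈ Span low-units → r ≤ toℕ i → x i ≈ 0#
      low-support {x} {i} (a , x≋au) r≤i = trans (x≋au i) (dot-zeroʳ a λ j →
        unit-off-diag λ low≡i → ℕₚ.<⇒≱ (toℕ<n j)
          (ℕₚ.≤-trans r≤i (ℕₚ.≤-reflexive (≡.trans (≡.cong toℕ (≡.sym low≡i)) (toℕ-low j)))))

      low-rank≤ : ∀ {x} → x ∈ Span low-units → Rank≤ t (unflatten {ℓ} {m} x)
      low-rank≤ {x} x∈low = rank≤-rows (unflatten x) (λ j → inject≤ j t≤ℓ) rows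
        where
        rows : ∀ i → (∃[ j ] inject≤ j t≤ℓ ≡ i) ⊎ unflatten {ℓ} {m} x i ≋ 0ᵛ
        rows i with toℕ i ℕₚ.<? t
        ... | yes i<t = inj₁ (fromℕ< i<t , toℕ-injective (≡.trans (toℕ-inject≤ _ t≤ℓ) (toℕ-fromℕ< i<t)))
        -- An entry in a row of index i ≥ t has row-major position m i + j ≥ t m ≥ r, hence lies
        -- beyond the low entries.
        ... | no  i≮t = inj₂ λ j → low-support x∈low (begin
          r                    ≤⟨ r≤tm ⟩
          t * m                ≡⟨ ℕₚ.*-comm t m ⟩
          m * t                ≤⟨ ℕₚ.*-monoʳ-≤ m (ℕₚ.≮⇒≥ i≮t) ⟩
          m * toℕ i            ≤⟨ ℕₚ.m≤m+n _ (toℕ j) ⟩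
          m * toℕ i ℕ.+ toℕ j  ≡⟨ toℕ-combine i j ⟨
          toℕ (combine i j)    ∎)
          where open ℕₚ.≤-Reasoning

      -- These generate the extremal subcode: the common zeros of the s high coordinate forms are
      -- exactly the matrices supported in the low entries.
      words : Vector (Vector Carrier n̂) s
      words j k = P k (high j)

      words-⊆ : Span words ⊆ member (determinantalCode points)
      words-⊆ = span-⊆ (determinantalCode points) words λ j → unflatten (unit (high j)) , λ k → begin
        P k (high j)                                           ≈⟨ dot-unit (high j) (P k) ⟨
        dot (unit (high j)) (P k)                              ≈⟨ dot-cong (flatten-unflatten {ℓ} {m} (unit (high j))) (λ _ → refl) ⟨
        dot (flatten {ℓ} {m} (unflatten (unit (high j)))) (P k) ≈⟨ linearForm-flatten (unflatten (unit (high j))) (representative points k) ⟨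
        linearForm (unflatten (unit (high j))) (representative points k)  ∎
        where open ≈-Reasoning

      words-independent : LinearlyIndependent words
      words-independent = coordinates-independent high-injective

      in-support? : ∀ k → Dec (∃[ j ] words j k # 0#)
      in-support? k = any? λ j → words j k #0?

      support : Subset n̂
      support = subset in-support?

      support-correct : ∀ k → k ∈ₛ support ⇔ (∃[ x ] x ∈ Span words × x k # 0#)
      support-correct k = mk⇔
        (λ k∈S → let (j , wⱼ#0) = Equivalence.to (∈-subset in-support? k) k∈S in words j , ∈-span words j , wⱼ#0)
        (λ (x , (a , x≋aw) , xₖ#0) → Equivalence.from (∈-subset in-support? k)
          -- If every generator vanished at `k`, so would every combination; decidability turns this
          -- into a witness.
          (decidable-stable (in-support? k) λ words≋0 →
            #⇒≉ xₖ#0 (trans (x≋aw k) (dot-zeroʳ a λ j → ¬#0⇒≈0 (words≋0 ∘ (j ,_))))))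

      -- Each basis word of `D` comes from some matrix. Evaluation is linear, so a relation among
      -- these matrices is a relation among the words; hence the matrices are independent and
      -- `annihilated-≤` bounds the points where `D` vanishes.
      zeros-≤ : ∀ (D : Subspace n̂) w → member D ⊆ member (determinantalCode points) →
                HasDimension (member D) s → HasSupportWeight D w → n̂ ∸ w ≤ geometricSum q r
      zeros-≤ D w D⊆C (v , independent , _ , v⊆D) (S , S-correct , ≡.refl) =
        ≡.subst (_≤ geometricSum q r) (∣∁p∣≡n∸∣p∣ S)
          (annihilated-≤ r (∁ S) (flatten ∘ A) A-independent
            (ℕₚ.≤-reflexive (≡.trans (≡.sym r+s≡ℓm) (ℕₚ.+-comm r s))) A⊥∁S)
        where
        v∈D : ∀ j → v j ∈ member D
        v∈D j = v⊆D (∈-span v j)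
        A : Fin s → Matrix ℓ m
        A j = proj₁ (D⊆C (v∈D j))
        v≈A·P : ∀ j k → v j k ≈ dot (flatten (A j)) (P k)
        v≈A·P j k = trans (proj₂ (D⊆C (v∈D j)) k) (linearForm-flatten (A j) (representative points k))
        A⊥∁S : ∀ j {k} → k ∈ₛ ∁ S → dot (flatten (A j)) (P k) ≈ 0#
        A⊥∁S j {k} k∈∁S = trans (sym (v≈A·P j k)) (¬#0⇒≈0 λ vⱼₖ#0 →
          x∈∁p⇒x∉p k∈∁S (Equivalence.from (S-correct k) (v j , v∈D j , vⱼₖ#0)))
        A-independent : LinearlyIndependent (flatten ∘ A)
        A-independent a aA≋0 = independent a λ k → begin
          dot a (λ j → v j k)                       ≈⟨ dot-cong {x = a} (λ _ → refl) (λ j → v≈A·P j k) ⟩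
          dot a (λ j → dot (flatten (A j)) (P k))   ≈⟨ dot-combination a (flatten ∘ A) (P k) ⟨
          dot (combination a (flatten ∘ A)) (P k)   ≈⟨ dot-comm _ (P k) ⟩
          dot (P k) (combination a (flatten ∘ A))   ≈⟨ dot-zeroʳ (P k) aA≋0 ⟩
          0#                                        ∎
          where open ≈-Reasoning

      -- Every nonzero low matrix has rank at most t, so it is a multiple of some evaluation point,
      -- and at that point all the high coordinates vanish.
      zeros-≥ : geometricSum q r ≤ n̂ ∸ ∣ support ∣
      zeros-≥ = ≡.subst (geometricSum q r ≤_) (∣∁p∣≡n∸∣p∣ support)
        (contained-≥ (∁ support) low-units low-independent contained)
        where
        contained : ∀ {x i} → x ∈ Span low-units → x i # 0# →
                    ∃₂ λ k a → k ∈ₛ ∁ support × a # 0# × x ≋ a *ᵛ P k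
        contained {x} x∈low xᵢ#0 with P-complete xᵢ#0 (low-rank≤ x∈low)
        ... | k , a , a#0 , x≋aP = k , a , x∉p⇒x∈∁p k∉S , a#0 , x≋aP
          where
          k∉S : ¬ (k ∈ₛ support)
          k∉S k∈S with Equivalence.to (∈-subset in-support? k) k∈S
          ... | j , wⱼₖ#0 = #⇒≉ wⱼₖ#0 (#0-cancelˡ a#0 (trans (sym (x≋aP (high j)))
            (trans (low-support x∈low (≡.subst (r ≤_) (≡.sym (toℕ-high j)) (ℕₚ.m≤m+n r _))) (sym (zeroʳ a)))))

      hammingWeight : ∃[ d ] IsGeneralizedHammingWeight (determinantalCode points) s d
                      × + d ≡ + n̂ - + geometricSum q r
      hammingWeight = ∣ support ∣
        , ((spanned words , words-⊆ , dimension , weight)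
          -- A smaller weight would leave `D` with strictly more zeros than the extremal subcode,
          -- which already attains the maximum.
          , λ D w D⊆C dim wt → ℕₚ.≮⇒≥ λ w<∣S∣ → ℕₚ.<⇒≱
              (ℕₚ.∸-monoʳ-< w<∣S∣ (∣p∣≤n support))
              (ℕₚ.≤-trans (zeros-≤ D w D⊆C dim wt) zeros-≥))
        , (begin
          + ∣ support ∣                 ≡⟨ ≡.cong +_ (ℕₚ.m∸[m∸n]≡n (∣p∣≤n support)) ⟨
          + (n̂ ∸ (n̂ ∸ ∣ support ∣))     ≡⟨ ≡.cong (λ z → + (n̂ ∸ z)) zeros≡ ⟩
          -- The geometric sum counts zero coordinates, so it is at most n̂ and truncated
          -- subtraction agrees with the integer difference.
          + (n̂ ∸ geometricSum q r)      ≡⟨ ⊖-≥ (≡.subst (_≤ n̂) zeros≡ (ℕₚ.m∸n≤m n̂ ∣ support ∣)) ⟨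
          n̂ ⊖ geometricSum q r          ≡⟨ m-n≡m⊖n n̂ (geometricSum q r) ⟨
          + n̂ - + geometricSum q r      ∎)
        where
        open ≡.≡-Reasoning
        dimension : HasDimension (Span words) s
        dimension = words , words-independent , id , id
        weight : HasSupportWeight (spanned words) ∣ support ∣
        weight = support , support-correct , ≡.refl
        zeros≡ : n̂ ∸ ∣ support ∣ ≡ geometricSum q r
        zeros≡ = ℕₚ.≤-antisym (zeros-≤ (spanned words) _ words-⊆ dimension weight) zeros-≥

mainTheorem10 : ∀ {c ℓ₁ ℓ₂} (q : ℕ) → IsPrimePower q →
    (F : HeytingField c ℓ₁ ℓ₂) → HasOrder F q →
    let open OverField F in
    (t ℓ m s : ℕ) → 1 ≤ t → t ≤ ℓ → ℓ ≤ m →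
    (ℓ ∸ t) * m ≤ s → s ≤ ℓ * m → 1 ≤ s →
    (n̂ : ℕ) (points : Enumeration t ℓ m n̂) →
    ∃[ d ] IsGeneralizedHammingWeight (determinantalCode points) s d
    × + d ≡ + n̂ - + geometricSum q (ℓ * m ∸ s)
-- A field contains `0#`, so its order is a successor.
mainTheorem10 ℕ.zero _ F order = contradiction (Inverse.from order (HeytingField.0# F)) λ ()
mainTheorem10 (ℕ.suc p) _ F order t ℓ m s 1≤t t≤ℓ _ [ℓ-t]m≤s s≤ℓm _ n̂ points =
  -- With r = ℓm - s, the lower bound (ℓ - t) m ≤ s becomes r ≤ t m.
  Weight.hammingWeight (ℕₚ.m∸n+n≡m s≤ℓm) (begin
    ℓ * m ∸ s               ≤⟨ ℕₚ.∸-monoʳ-≤ (ℓ * m) [ℓ-t]m≤s ⟩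
    ℓ * m ∸ (ℓ ∸ t) * m     ≡⟨ ℕₚ.*-distribʳ-∸ m ℓ (ℓ ∸ t) ⟨
    (ℓ ∸ (ℓ ∸ t)) * m       ≡⟨ ≡.cong (_* m) (ℕₚ.m∸[m∸n]≡n t≤ℓ) ⟩
    t * m                   ∎)
  where
  open FiniteField.Code F p order 1≤t t≤ℓ points
  open ℕₚ.≤-Reasoning
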